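{- Let $\mathbb{P}$ be the set of all process terms. Let $$\mathfrak{U} = \{P \in \mathbb{P} \mid \exists\, \Gamma, \Delta, \Lambda \text{ such that } \Gamma; \Delta \vdash P :: \Lambda\}$$ be the set of processes typable in the type system $\pi\mathsf{ULL}$, and let $$\mathfrak{I} = \{P \in \mathbb{P} \mid \exists\, \Gamma, \Delta,\ x \in \mathrm{fn}(P),\ A \text{ such that } \Gamma; \Delta \vdash_{\mathsf{ILL}} P :: x:A\}$$ be the set of processes typable in the intuitionistic type system $\pi\mathsf{ILL}$. Then $\mathfrak{I}$ is a strict subset of $\mathfrak{U}$: $\mathfrak{I} \subset \mathfrak{U}$ and $\mathfrak{I}\neq\mathfrak{U}$.
   Context: **Types.** $A,B ::= \mathbf{1} \mid \bot \mid A \otimes B \mid A ⅋ B \mid A \multimap B \mid\ !A \mid\ ?A$ (no atoms). Duality: $\mathbf{1}^\perp=\bot$, $\bot^\perp=\mathbf{1}$, $(A\otimes B)^\perp = A^\perp ⅋ B^\perp$, $(A ⅋ B)^\perp = A^\perp\otimes B^\perp$, $(!A)^\perp = {?}A^\perp$, $(?A)^\perp = {!}A^\perp$. By decree $A\multimap B = A^\perp ⅋ B$ (these are identified). Duality is an involution. **Processes.** $P,Q ::= \mathbf{0} \mid [x\leftrightarrow y] \mid (\nu x)P \mid P|Q \mid x\langle y\rangle.P \mid x(y).P \mid\ !x(y).P \mid x\langle\rangle.\mathbf{0} \mid x().P$. The constructs $(\nu x)P$, $z(x).P$, $!z(x).P$ bind $x$ in $P$; the output $x\langle y\rangle.P$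 binds nothing. $\mathrm{fn}(P)$ is the set of free names of $P$. $P\{y/x\}$ is capture-avoiding substitution of $y$ for free $x$. Terms are taken up to $\alpha$-conversion. **Contexts.** $\Gamma,\Delta,\Lambda$ are finite unordered collections of assignments $x:A$ with pairwise distinct names; a comma denotes disjoint union, $\cdot$ is empty. $\Gamma$ is unrestricted, the others are linear. **System $\pi\mathsf{ULL}$** (judgments $\Gamma;\Delta\vdash P::\Lambda$; premises $\Rightarrow$ conclusion; primed contexts are arbitrary). Some rules are marked $\ast$: - $\ast$ Id R: $\Gamma; x:A \vdash [x\leftrightarrow y] :: y:A$. - Id L: $\Gamma; x:A, y:A^\perp \vdash [x\leftrightarrow y] :: \cdot$. - $\ast$ Cut R: $\Gamma;\Delta\vdash P::\Lambda,x:A$ and $\Gamma;\Delta',x:A\vdash Q::\Lambda'$ $\Rightarrow$ $\Gamma;\Delta,\Delta'\vdash(\nu x)(P|Q)::\Lambda,\Lambda'$. - Cut L: $\Gamma;\Delta,x:A\vdash P::\Lambda$ and $\Gamma;\Delta',x:A^\perp\vdash Q::\Lambda'$ $\Rightarrow$ $\Gamma;\Delta,\Delta'\vdash(\nu x)(P|Q)::\Lambda,\Lambda'$. - $\ast$ Cut! R: $\Gamma;\cdot\vdash P::y:A$ and $\Gamma,u:A;\Delta\vdash Q::\Lambda$ $\Rightarrow$ $\Gamma;\Delta\vdash(\nu u)(!u(y).P\,|\,Q)::\Lambda$. - Cut! L: $\Gamma;y:A^\perp\vdash P::\cdot$ and $\Gamma,u:A;\Delta\vdash Q::\Lambda$ $\Rightarrow$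 $\Gamma;\Delta\vdash(\nu u)(!u(y).P\,|\,Q)::\Lambda$. - $\ast$ Copy L: $\Gamma,u:A;\Delta,y:A\vdash P::\Lambda$ $\Rightarrow$ $\Gamma,u:A;\Delta\vdash(\nu y)u\langle y\rangle.P::\Lambda$. - Copy R: $\Gamma,u:A;\Delta\vdash P::\Lambda,y:A^\perp$ $\Rightarrow$ $\Gamma,u:A;\Delta\vdash(\nu y)u\langle y\rangle.P::\Lambda$. - $\ast$ $\mathbf 1$R: $\Gamma;\cdot\vdash x\langle\rangle.\mathbf 0::x:\mathbf 1$. - $\ast$ $\mathbf 1$L: $\Gamma;\Delta\vdash P::\Lambda$ $\Rightarrow$ $\Gamma;\Delta,x:\mathbf 1\vdash x().P::\Lambda$. - $\bot$R: $\Gamma;\Delta\vdash P::\Lambda$ $\Rightarrow$ $\Gamma;\Delta\vdash x().P::\Lambda,x:\bot$. - $\bot$L: $\Gamma;x:\bot\vdash x\langle\rangle.\mathbf 0::\cdot$. - $\ast$ $\otimes$R: $\Gamma;\Delta\vdash P::\Lambda,y:A$ and $\Gamma;\Delta'\vdash Q::\Lambda',x:B$ $\Rightarrow$ $\Gamma;\Delta,\Delta'\vdash(\nu y)x\langle y\rangle.(P|Q)::\Lambda,\Lambda',x:A\otimes B$. - $\ast$ $\otimes$L: $\Gamma;\Delta,y:A,x:B\vdash P::\Lambda$ $\Rightarrow$ $\Gamma;\Delta,x:A\otimes B\vdash x(y).P::\Lambda$. - $⅋$R: $\Gamma;\Delta\vdash P::\Lambda,y:A,x:B$ $\Rightarrow$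 $\Gamma;\Delta\vdash x(y).P::\Lambda,x:A⅋B$. - $⅋$L: $\Gamma;\Delta,y:A\vdash P::\Lambda$ and $\Gamma;\Delta',x:B\vdash Q::\Lambda'$ $\Rightarrow$ $\Gamma;\Delta,\Delta',x:A⅋B\vdash(\nu y)x\langle y\rangle.(P|Q)::\Lambda,\Lambda'$. - $\ast$ $\multimap$R: $\Gamma;\Delta,y:A\vdash P::\Lambda,x:B$ $\Rightarrow$ $\Gamma;\Delta\vdash x(y).P::\Lambda,x:A\multimap B$. - $\ast$ $\multimap$L: $\Gamma;\Delta\vdash P::\Lambda,y:A$ and $\Gamma;\Delta',x:B\vdash Q::\Lambda'$ $\Rightarrow$ $\Gamma;\Delta,\Delta',x:A\multimap B\vdash(\nu y)x\langle y\rangle.(P|Q)::\Lambda,\Lambda'$. - $\ast$ $!$R: $\Gamma;\cdot\vdash P::y:A$ $\Rightarrow$ $\Gamma;\cdot\vdash\ !x(y).P::x:{!}A$. - $\ast$ $!$L: $\Gamma,u:A;\Delta\vdash P::\Lambda$ $\Rightarrow$ $\Gamma;\Delta,x:{!}A\vdash P\{x/u\}::\Lambda$. - $?$R: $\Gamma,u:A;\Delta\vdash P::\Lambda$ $\Rightarrow$ $\Gamma;\Delta\vdash P\{x/u\}::\Lambda,x:{?}A^\perp$. - $?$L: $\Gamma;y:A\vdash P::\cdot$ $\Rightarrow$ $\Gamma;x:{?}A\vdash\ !x(y).P::\cdot$. **System $\pi\mathsf{ILL}$** (judgments $\Gamma;\Delta\vdash_{\mathsf{ILL}}P::z:C$,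 with exactly one assignment on the right; write $\vdash$ for $\vdash_{\mathsf{ILL}}$). Its rules are the $\ast$-marked rules with every sequent having exactly one assignment on the right, namely: - Id: $\Gamma;x:A\vdash[x\leftrightarrow y]::y:A$. - Cut: $\Gamma;\Delta\vdash P::x:A$ and $\Gamma;\Delta',x:A\vdash Q::z:C$ $\Rightarrow$ $\Gamma;\Delta,\Delta'\vdash(\nu x)(P|Q)::z:C$. - Cut!: $\Gamma;\cdot\vdash P::y:A$ and $\Gamma,u:A;\Delta\vdash Q::z:C$ $\Rightarrow$ $\Gamma;\Delta\vdash(\nu u)(!u(y).P\,|\,Q)::z:C$. - Copy: $\Gamma,u:A;\Delta,y:A\vdash P::z:C$ $\Rightarrow$ $\Gamma,u:A;\Delta\vdash(\nu y)u\langle y\rangle.P::z:C$. - $\mathbf 1$R: $\Gamma;\cdot\vdash x\langle\rangle.\mathbf 0::x:\mathbf 1$. - $\mathbf 1$L: $\Gamma;\Delta\vdash P::z:C$ $\Rightarrow$ $\Gamma;\Delta,x:\mathbf 1\vdash x().P::z:C$. - $\otimes$R: $\Gamma;\Delta\vdash P::y:A$ and $\Gamma;\Delta'\vdash Q::x:B$ $\Rightarrow$ $\Gamma;\Delta,\Delta'\vdash(\nu y)x\langle y\rangle.(P|Q)::x:A\otimes B$. - $\otimes$L: $\Gamma;\Delta,y:A,x:B\vdash P::z:C$ $\Rightarrow$ $\Gamma;\Delta,x:A\otimes B\vdash x(y).P::z:C$. - $\multimap$R: $\Gamma;\Delta,y:A\vdash P::x:B$ $\Rightarrow$ $\Gamma;\Delta\vdash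 x(y).P::x:A\multimap B$. - $\multimap$L: $\Gamma;\Delta\vdash P::y:A$ and $\Gamma;\Delta',x:B\vdash Q::z:C$ $\Rightarrow$ $\Gamma;\Delta,\Delta',x:A\multimap B\vdash(\nu y)x\langle y\rangle.(P|Q)::z:C$. - $!$R: $\Gamma;\cdot\vdash P::y:A$ $\Rightarrow$ $\Gamma;\cdot\vdash\ !x(y).P::x:{!}A$. - $!$L: $\Gamma,u:A;\Delta\vdash P::z:C$ $\Rightarrow$ $\Gamma;\Delta,x:{!}A\vdash P\{x/u\}::z:C$. -}

module Defs where

open import Data.Fin.Base using (Fin; fromℕ; inject₁)
open import Data.List.Base using (List; []; _∷_; _++_; map)
open import Data.List.Membership.Propositional using (_∈_; _∉_)
open import Data.List.Relation.Binary.Permutation.Propositional using (_↭_)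
open import Data.List.Relation.Unary.Unique.Propositional using (Unique)
open import Data.Nat.Base using (ℕ; suc)
open import Data.Nat.Properties using (_≟_)
open import Data.Product.Base using (_×_; _,_; proj₁; ∃-syntax)
open import Level using (0ℓ)
open import Relation.Nullary.Decidable.Core using (yes; no)
open import Relation.Unary using (Pred)

------------------------------------------------------------------------
-- Types

infixr 8 _⊗_ _⅋_ _⊸_
infix  9 !_ ¿_
infix  10 _^⊥

data Type : Set where
  𝟏 ⊥     : Type
  _⊗_ _⅋_ : Type → Type → Type
  !_ ¿_   : Type → Type

_^⊥ : Type → Type
𝟏 ^⊥       = ⊥
⊥ ^⊥       = 𝟏
(A ⊗ B) ^⊥ = A ^⊥ ⅋ B ^⊥
(A ⅋ B) ^⊥ = A ^⊥ ⊗ B ^⊥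
(! A) ^⊥   = ¿ (A ^⊥)
(¿ A) ^⊥   = ! (A ^⊥)

-- Lolli is not a constructor, because A ⊸ B and A ^⊥ ⅋ B are the same type.
_⊸_ : Type → Type → Type
A ⊸ B = A ^⊥ ⅋ B

------------------------------------------------------------------------
-- Processes
--
-- Terms up to α-conversion are represented by well-scoped locally
-- nameless syntax: free names are named, bound names are de Bruijn indices
-- (zero is the innermost binder).  α-equivalent terms are thus equal, and
-- process terms are the elements of Proc 0.

Name : Set
Name = ℕ

data Ref (n : ℕ) : Set where
  free  : Name → Ref n
  bound : Fin n → Ref n

data Proc (n : ℕ) : Set where
  nil   : Proc n
  fwd   : Ref n → Ref n → Proc n
  res   : Proc (suc n) → Proc n
  par   : Proc n → Proc n → Proc n
  out   : Ref n → Ref n → Proc n → Proc n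
  inp   : Ref n → Proc (suc n) → Proc n
  srv   : Ref n → Proc (suc n) → Proc n
  close : Ref n → Proc n
  wait  : Ref n → Proc n → Proc n

Process : Set
Process = Proc 0

fnRef : ∀ {n} → Ref n → List Name
fnRef (free x)  = x ∷ []
fnRef (bound _) = []

fn : ∀ {n} → Proc n → List Name
fn nil         = []
fn (fwd a b)   = fnRef a ++ fnRef b
fn (res P)     = fn P
fn (par P Q)   = fn P ++ fn Q
fn (out a b P) = fnRef a ++ fnRef b ++ fn P
fn (inp a P)   = fnRef a ++ fn P
fn (srv a P)   = fnRef a ++ fn P
fn (close a)   = fnRef a
fn (wait a P)  = fnRef a ++ fn P

-- P [ y / x ] replaces free x by y.  A plain traversal is capture-avoiding,
-- since binders carry no names.

infix 20 _[_/_]ᴿ _[_/_]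

_[_/_]ᴿ : ∀ {n} → Ref n → Name → Name → Ref n
free z [ y / x ]ᴿ with z ≟ x
... | yes _ = free y
... | no  _ = free z
bound i [ y / x ]ᴿ = bound i

_[_/_] : ∀ {n} → Proc n → Name → Name → Proc n
nil       [ y / x ] = nil
fwd a b   [ y / x ] = fwd (a [ y / x ]ᴿ) (b [ y / x ]ᴿ)
res P     [ y / x ] = res (P [ y / x ])
par P Q   [ y / x ] = par (P [ y / x ]) (Q [ y / x ])
out a b P [ y / x ] = out (a [ y / x ]ᴿ) (b [ y / x ]ᴿ) (P [ y / x ])
inp a P   [ y / x ] = inp (a [ y / x ]ᴿ) (P [ y / x ])
srv a P   [ y / x ] = srv (a [ y / x ]ᴿ) (P [ y / x ])
close a   [ y / x ] = close (a [ y / x ]ᴿ)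
wait a P  [ y / x ] = wait (a [ y / x ]ᴿ) (P [ y / x ])

-- bind x P turns the free name x into a reference to a new binder around
-- all the existing ones, which is why its index is the largest one and the
-- other indices do not shift.

bindRef : ∀ {n} → Name → Ref n → Ref (suc n)
bindRef {n} x (free z) with z ≟ x
... | yes _ = bound (fromℕ n)
... | no  _ = free z
bindRef x (bound i) = bound (inject₁ i)

bind : ∀ {n} → Name → Proc n → Proc (suc n)
bind x nil         = nil
bind x (fwd a b)   = fwd (bindRef x a) (bindRef x b)
bind x (res P)     = res (bind x P)
bind x (par P Q)   = par (bind x P) (bind x Q)
bind x (out a b P) = out (bindRef x a) (bindRef x b) (bind x P)
bind x (inp a P)   = inp (bindRef x a) (bind x P)
bind x (srv a P)   = srv (bindRef x a) (bind x P)
bind x (close a)   = close (bindRef x a)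
bind x (wait a P)  = wait (bindRef x a) (bind x P)

-- The usual named notation.  In ν x ∙ P, z ⦅ x ⦆∙ P and !ₚ z ⦅ x ⦆∙ P the
-- name x is bound in P (and not in z); x ⟨ y ⟩∙ P binds nothing.

infixr 12 ν_∙_ _⟨_⟩∙_ _⦅_⦆∙_ !ₚ_⦅_⦆∙_ _⦅⦆∙_
infixr 11 _∣_

𝟎 : Process
𝟎 = nil

[_↔_] : Name → Name → Process
[ x ↔ y ] = fwd (free x) (free y)

ν_∙_ : Name → Process → Process
ν x ∙ P = res (bind x P)

_∣_ : Process → Process → Process
P ∣ Q = par P Q

_⟨_⟩∙_ : Name → Name → Process → Process
x ⟨ y ⟩∙ P = out (free x) (free y) P

_⦅_⦆∙_ : Name → Name → Process → Process
z ⦅ x ⦆∙ P = inp (free z) (bind x P)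

!ₚ_⦅_⦆∙_ : Name → Name → Process → Process
!ₚ z ⦅ x ⦆∙ P = srv (free z) (bind x P)

_⟨⟩∙𝟎 : Name → Process
x ⟨⟩∙𝟎 = close (free x)

_⦅⦆∙_ : Name → Process → Process
x ⦅⦆∙ P = wait (free x) P

------------------------------------------------------------------------
-- Contexts
--
-- Unordered collections are lists, with both type systems closed under
-- permutation (rule exch).

infix 6 _∶_

pattern _∶_ x A = x , A

Assignment : Set
Assignment = Name × Type

Context : Set
Context = List Assignment

dom : Context → List Name
dom = map proj₁

-- All names of a sequent are pairwise distinct.  Every rule demands this of
-- its conclusion (exch preserves it), hence it holds throughout a derivation.
Distinct : Context → Context → Context → Set
Distinct Γ Δ Λ = Unique (dom (Γ ++ Δ ++ Λ))

-- The bound name of an output with two premises is typed in one premise only;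
-- the usual convention on bound names keeps it from capturing a name of the
-- other one.  (For the other binders this already follows from Distinct.)
Fresh : Name → Context → Context → Context → Set
Fresh y Γ Δ Λ = y ∉ dom (Γ ++ Δ ++ Λ)

------------------------------------------------------------------------
-- System πULL

infix 4 _⨾_⊢_⦂_ _⨾_⊢ᴵ_⦂_

data _⨾_⊢_⦂_ : Context → Context → Process → Context → Set where

  exch : ∀ {Γ Γ′ Δ Δ′ Λ Λ′ P} → Γ ↭ Γ′ → Δ ↭ Δ′ → Λ ↭ Λ′ →
         Γ ⨾ Δ ⊢ P ⦂ Λ →
         Γ′ ⨾ Δ′ ⊢ P ⦂ Λ′

  IdR  : ∀ {Γ x y A} →
         Distinct Γ (x ∶ A ∷ []) (y ∶ A ∷ []) →
         Γ ⨾ x ∶ A ∷ [] ⊢ [ x ↔ y ] ⦂ y ∶ A ∷ []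

  IdL  : ∀ {Γ x y A} →
         Distinct Γ (x ∶ A ∷ y ∶ A ^⊥ ∷ []) [] →
         Γ ⨾ x ∶ A ∷ y ∶ A ^⊥ ∷ [] ⊢ [ x ↔ y ] ⦂ []

  CutR : ∀ {Γ Δ Δ′ Λ Λ′ P Q x A} →
         Distinct Γ (Δ ++ Δ′) (Λ ++ Λ′) →
         Γ ⨾ Δ ⊢ P ⦂ x ∶ A ∷ Λ →
         Γ ⨾ x ∶ A ∷ Δ′ ⊢ Q ⦂ Λ′ →
         Γ ⨾ Δ ++ Δ′ ⊢ ν x ∙ (P ∣ Q) ⦂ Λ ++ Λ′

  CutL : ∀ {Γ Δ Δ′ Λ Λ′ P Q x A} →
         Distinct Γ (Δ ++ Δ′) (Λ ++ Λ′) →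
         Γ ⨾ x ∶ A ∷ Δ ⊢ P ⦂ Λ →
         Γ ⨾ x ∶ A ^⊥ ∷ Δ′ ⊢ Q ⦂ Λ′ →
         Γ ⨾ Δ ++ Δ′ ⊢ ν x ∙ (P ∣ Q) ⦂ Λ ++ Λ′

  Cut!R : ∀ {Γ Δ Λ P Q u y A} →
         Distinct Γ Δ Λ →
         Γ ⨾ [] ⊢ P ⦂ y ∶ A ∷ [] →
         u ∶ A ∷ Γ ⨾ Δ ⊢ Q ⦂ Λ →
         Γ ⨾ Δ ⊢ ν u ∙ ((!ₚ u ⦅ y ⦆∙ P) ∣ Q) ⦂ Λ

  Cut!L : ∀ {Γ Δ Λ P Q u y A} →
         Distinct Γ Δ Λ →
         Γ ⨾ y ∶ A ^⊥ ∷ [] ⊢ P ⦂ [] →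
         u ∶ A ∷ Γ ⨾ Δ ⊢ Q ⦂ Λ →
         Γ ⨾ Δ ⊢ ν u ∙ ((!ₚ u ⦅ y ⦆∙ P) ∣ Q) ⦂ Λ

  CopyL : ∀ {Γ Δ Λ P u y A} →
         Distinct (u ∶ A ∷ Γ) Δ Λ →
         u ∶ A ∷ Γ ⨾ y ∶ A ∷ Δ ⊢ P ⦂ Λ →
         u ∶ A ∷ Γ ⨾ Δ ⊢ ν y ∙ u ⟨ y ⟩∙ P ⦂ Λ

  CopyR : ∀ {Γ Δ Λ P u y A} →
         Distinct (u ∶ A ∷ Γ) Δ Λ →
         u ∶ A ∷ Γ ⨾ Δ ⊢ P ⦂ y ∶ A ^⊥ ∷ Λ →
         u ∶ A ∷ Γ ⨾ Δ ⊢ ν y ∙ u ⟨ y ⟩∙ P ⦂ Λ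

  𝟏R   : ∀ {Γ x} →
         Distinct Γ [] (x ∶ 𝟏 ∷ []) →
         Γ ⨾ [] ⊢ x ⟨⟩∙𝟎 ⦂ x ∶ 𝟏 ∷ []

  𝟏L   : ∀ {Γ Δ Λ P x} →
         Distinct Γ (x ∶ 𝟏 ∷ Δ) Λ →
         Γ ⨾ Δ ⊢ P ⦂ Λ →
         Γ ⨾ x ∶ 𝟏 ∷ Δ ⊢ x ⦅⦆∙ P ⦂ Λ

  ⊥R   : ∀ {Γ Δ Λ P x} →
         Distinct Γ Δ (x ∶ ⊥ ∷ Λ) →
         Γ ⨾ Δ ⊢ P ⦂ Λ →
         Γ ⨾ Δ ⊢ x ⦅⦆∙ P ⦂ x ∶ ⊥ ∷ Λ

  ⊥L   : ∀ {Γ x} →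
         Distinct Γ (x ∶ ⊥ ∷ []) [] →
         Γ ⨾ x ∶ ⊥ ∷ [] ⊢ x ⟨⟩∙𝟎 ⦂ []

  ⊗R   : ∀ {Γ Δ Δ′ Λ Λ′ P Q x y A B} →
         Distinct Γ (Δ ++ Δ′) (x ∶ A ⊗ B ∷ Λ ++ Λ′) →
         Fresh y Γ (Δ ++ Δ′) (x ∶ A ⊗ B ∷ Λ ++ Λ′) →
         Γ ⨾ Δ ⊢ P ⦂ y ∶ A ∷ Λ →
         Γ ⨾ Δ′ ⊢ Q ⦂ x ∶ B ∷ Λ′ →
         Γ ⨾ Δ ++ Δ′ ⊢ ν y ∙ x ⟨ y ⟩∙ (P ∣ Q) ⦂ x ∶ A ⊗ B ∷ Λ ++ Λ′

  ⊗L   : ∀ {Γ Δ Λ P x y A B} →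
         Distinct Γ (x ∶ A ⊗ B ∷ Δ) Λ →
         Γ ⨾ y ∶ A ∷ x ∶ B ∷ Δ ⊢ P ⦂ Λ →
         Γ ⨾ x ∶ A ⊗ B ∷ Δ ⊢ x ⦅ y ⦆∙ P ⦂ Λ

  ⅋R   : ∀ {Γ Δ Λ P x y A B} →
         Distinct Γ Δ (x ∶ A ⅋ B ∷ Λ) →
         Γ ⨾ Δ ⊢ P ⦂ y ∶ A ∷ x ∶ B ∷ Λ →
         Γ ⨾ Δ ⊢ x ⦅ y ⦆∙ P ⦂ x ∶ A ⅋ B ∷ Λ

  ⅋L   : ∀ {Γ Δ Δ′ Λ Λ′ P Q x y A B} →
         Distinct Γ (x ∶ A ⅋ B ∷ Δ ++ Δ′) (Λ ++ Λ′) →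
         Fresh y Γ (x ∶ A ⅋ B ∷ Δ ++ Δ′) (Λ ++ Λ′) →
         Γ ⨾ y ∶ A ∷ Δ ⊢ P ⦂ Λ →
         Γ ⨾ x ∶ B ∷ Δ′ ⊢ Q ⦂ Λ′ →
         Γ ⨾ x ∶ A ⅋ B ∷ Δ ++ Δ′ ⊢ ν y ∙ x ⟨ y ⟩∙ (P ∣ Q) ⦂ Λ ++ Λ′

  ⊸R   : ∀ {Γ Δ Λ P x y A B} →
         Distinct Γ Δ (x ∶ A ⊸ B ∷ Λ) →
         Γ ⨾ y ∶ A ∷ Δ ⊢ P ⦂ x ∶ B ∷ Λ →
         Γ ⨾ Δ ⊢ x ⦅ y ⦆∙ P ⦂ x ∶ A ⊸ B ∷ Λ

  ⊸L   : ∀ {Γ Δ Δ′ Λ Λ′ P Q x y A B} →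
         Distinct Γ (x ∶ A ⊸ B ∷ Δ ++ Δ′) (Λ ++ Λ′) →
         Fresh y Γ (x ∶ A ⊸ B ∷ Δ ++ Δ′) (Λ ++ Λ′) →
         Γ ⨾ Δ ⊢ P ⦂ y ∶ A ∷ Λ →
         Γ ⨾ x ∶ B ∷ Δ′ ⊢ Q ⦂ Λ′ →
         Γ ⨾ x ∶ A ⊸ B ∷ Δ ++ Δ′ ⊢ ν y ∙ x ⟨ y ⟩∙ (P ∣ Q) ⦂ Λ ++ Λ′

  !R   : ∀ {Γ P x y A} →
         Distinct Γ [] (x ∶ ! A ∷ []) →
         Γ ⨾ [] ⊢ P ⦂ y ∶ A ∷ [] →
         Γ ⨾ [] ⊢ !ₚ x ⦅ y ⦆∙ P ⦂ x ∶ ! A ∷ []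

  !L   : ∀ {Γ Δ Λ P u x A} →
         Distinct Γ (x ∶ ! A ∷ Δ) Λ →
         u ∶ A ∷ Γ ⨾ Δ ⊢ P ⦂ Λ →
         Γ ⨾ x ∶ ! A ∷ Δ ⊢ P [ x / u ] ⦂ Λ

  ¿R   : ∀ {Γ Δ Λ P u x A} →
         Distinct Γ Δ (x ∶ ¿ (A ^⊥) ∷ Λ) →
         u ∶ A ∷ Γ ⨾ Δ ⊢ P ⦂ Λ →
         Γ ⨾ Δ ⊢ P [ x / u ] ⦂ x ∶ ¿ (A ^⊥) ∷ Λ

  ¿L   : ∀ {Γ P x y A} →
         Distinct Γ (x ∶ ¿ A ∷ []) [] →
         Γ ⨾ y ∶ A ∷ [] ⊢ P ⦂ [] →
         Γ ⨾ x ∶ ¿ A ∷ [] ⊢ !ₚ x ⦅ y ⦆∙ P ⦂ []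

------------------------------------------------------------------------
-- System πILL

data _⨾_⊢ᴵ_⦂_ : Context → Context → Process → Assignment → Set where

  exch : ∀ {Γ Γ′ Δ Δ′ P z C} → Γ ↭ Γ′ → Δ ↭ Δ′ →
         Γ ⨾ Δ ⊢ᴵ P ⦂ z ∶ C →
         Γ′ ⨾ Δ′ ⊢ᴵ P ⦂ z ∶ C

  Id   : ∀ {Γ x y A} →
         Distinct Γ (x ∶ A ∷ []) (y ∶ A ∷ []) →
         Γ ⨾ x ∶ A ∷ [] ⊢ᴵ [ x ↔ y ] ⦂ y ∶ A

  Cut  : ∀ {Γ Δ Δ′ P Q x z A C} →
         Distinct Γ (Δ ++ Δ′) (z ∶ C ∷ []) →
         Γ ⨾ Δ ⊢ᴵ P ⦂ x ∶ A →
         Γ ⨾ x ∶ A ∷ Δ′ ⊢ᴵ Q ⦂ z ∶ C →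
         Γ ⨾ Δ ++ Δ′ ⊢ᴵ ν x ∙ (P ∣ Q) ⦂ z ∶ C

  Cut! : ∀ {Γ Δ P Q u y z A C} →
         Distinct Γ Δ (z ∶ C ∷ []) →
         Γ ⨾ [] ⊢ᴵ P ⦂ y ∶ A →
         u ∶ A ∷ Γ ⨾ Δ ⊢ᴵ Q ⦂ z ∶ C →
         Γ ⨾ Δ ⊢ᴵ ν u ∙ ((!ₚ u ⦅ y ⦆∙ P) ∣ Q) ⦂ z ∶ C

  Copy : ∀ {Γ Δ P u y z A C} →
         Distinct (u ∶ A ∷ Γ) Δ (z ∶ C ∷ []) →
         u ∶ A ∷ Γ ⨾ y ∶ A ∷ Δ ⊢ᴵ P ⦂ z ∶ C →
         u ∶ A ∷ Γ ⨾ Δ ⊢ᴵ ν y ∙ u ⟨ y ⟩∙ P ⦂ z ∶ C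

  𝟏R   : ∀ {Γ x} →
         Distinct Γ [] (x ∶ 𝟏 ∷ []) →
         Γ ⨾ [] ⊢ᴵ x ⟨⟩∙𝟎 ⦂ x ∶ 𝟏

  𝟏L   : ∀ {Γ Δ P x z C} →
         Distinct Γ (x ∶ 𝟏 ∷ Δ) (z ∶ C ∷ []) →
         Γ ⨾ Δ ⊢ᴵ P ⦂ z ∶ C →
         Γ ⨾ x ∶ 𝟏 ∷ Δ ⊢ᴵ x ⦅⦆∙ P ⦂ z ∶ C

  ⊗R   : ∀ {Γ Δ Δ′ P Q x y A B} →
         Distinct Γ (Δ ++ Δ′) (x ∶ A ⊗ B ∷ []) →
         Fresh y Γ (Δ ++ Δ′) (x ∶ A ⊗ B ∷ []) →
         Γ ⨾ Δ ⊢ᴵ P ⦂ y ∶ A →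
         Γ ⨾ Δ′ ⊢ᴵ Q ⦂ x ∶ B →
         Γ ⨾ Δ ++ Δ′ ⊢ᴵ ν y ∙ x ⟨ y ⟩∙ (P ∣ Q) ⦂ x ∶ A ⊗ B

  ⊗L   : ∀ {Γ Δ P x y z A B C} →
         Distinct Γ (x ∶ A ⊗ B ∷ Δ) (z ∶ C ∷ []) →
         Γ ⨾ y ∶ A ∷ x ∶ B ∷ Δ ⊢ᴵ P ⦂ z ∶ C →
         Γ ⨾ x ∶ A ⊗ B ∷ Δ ⊢ᴵ x ⦅ y ⦆∙ P ⦂ z ∶ C

  ⊸R   : ∀ {Γ Δ P x y A B} →
         Distinct Γ Δ (x ∶ A ⊸ B ∷ []) →
         Γ ⨾ y ∶ A ∷ Δ ⊢ᴵ P ⦂ x ∶ B →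
         Γ ⨾ Δ ⊢ᴵ x ⦅ y ⦆∙ P ⦂ x ∶ A ⊸ B

  ⊸L   : ∀ {Γ Δ Δ′ P Q x y z A B C} →
         Distinct Γ (x ∶ A ⊸ B ∷ Δ ++ Δ′) (z ∶ C ∷ []) →
         Fresh y Γ (x ∶ A ⊸ B ∷ Δ ++ Δ′) (z ∶ C ∷ []) →
         Γ ⨾ Δ ⊢ᴵ P ⦂ y ∶ A →
         Γ ⨾ x ∶ B ∷ Δ′ ⊢ᴵ Q ⦂ z ∶ C →
         Γ ⨾ x ∶ A ⊸ B ∷ Δ ++ Δ′ ⊢ᴵ ν y ∙ x ⟨ y ⟩∙ (P ∣ Q) ⦂ z ∶ C

  !R   : ∀ {Γ P x y A} →
         Distinct Γ [] (x ∶ ! A ∷ []) →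
         Γ ⨾ [] ⊢ᴵ P ⦂ y ∶ A →
         Γ ⨾ [] ⊢ᴵ !ₚ x ⦅ y ⦆∙ P ⦂ x ∶ ! A

  !L   : ∀ {Γ Δ P u x z A C} →
         Distinct Γ (x ∶ ! A ∷ Δ) (z ∶ C ∷ []) →
         u ∶ A ∷ Γ ⨾ Δ ⊢ᴵ P ⦂ z ∶ C →
         Γ ⨾ x ∶ ! A ∷ Δ ⊢ᴵ P [ x / u ] ⦂ z ∶ C

------------------------------------------------------------------------
-- Typable processes

𝔘 : Pred Process 0ℓ
𝔘 P = ∃[ Γ ] ∃[ Δ ] ∃[ Λ ] Γ ⨾ Δ ⊢ P ⦂ Λ

ℑ : Pred Process 0ℓ
ℑ P = ∃[ Γ ] ∃[ Δ ] ∃[ x ] ∃[ A ] x ∈ fn P × Γ ⨾ Δ ⊢ᴵ P ⦂ x ∶ A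

{-# OPTIONS --safe #-}
-- Every rule of πILL is a rule of πULL with a singleton right-hand context.
-- For strictness, the process ν y ∙ u ⟨ y ⟩∙ y ⟨⟩∙𝟎 is typable in πULL with
-- u ∶ ⊥ unrestricted and an empty right-hand side.  Its only free name is u, so
-- membership in ℑ would put u on the right.  But a process of this shape comes
-- from Copy or !L, which put u on the left (unless !L renames some other name),
-- and the names of a sequent are distinct.
module Submission where

open import Defs
open import Data.List.Base using ([]; _∷_)
open import Data.List.Membership.Propositional.Properties using (∈-map⁺; ∈-++⁺ʳ)
open import Data.List.Relation.Binary.Permutation.Propositional using (↭-refl)
open import Data.List.Relation.Unary.All using ([]; _∷_; lookup)
open import Data.List.Relation.Unary.AllPairs using ([]; _∷_)
open import Data.List.Relation.Unary.Any using (here; there)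
open import Data.Nat.Properties using (_≟_)
open import Data.Product using (_×_; _,_; proj₁; proj₂)
open import Data.Sum using (_⊎_; inj₁; inj₂)
open import Relation.Binary.PropositionalEquality using (_≡_; _≢_; refl)
open import Relation.Nullary using (¬_; yes; no)
open import Relation.Unary using (_⊆_; _≐_)

ILL⇒ULL : ∀ {Γ Δ P z C} → Γ ⨾ Δ ⊢ᴵ P ⦂ z ∶ C → Γ ⨾ Δ ⊢ P ⦂ z ∶ C ∷ []
ILL⇒ULL (exch p q d)  = exch p q ↭-refl (ILL⇒ULL d)
ILL⇒ULL (Id u)        = IdR u
ILL⇒ULL (Cut u d e)   = CutR u (ILL⇒ULL d) (ILL⇒ULL e)
ILL⇒ULL (Cut! u d e)  = Cut!R u (ILL⇒ULL d) (ILL⇒ULL e)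
ILL⇒ULL (Copy u d)    = CopyL u (ILL⇒ULL d)
ILL⇒ULL (𝟏R u)        = 𝟏R u
ILL⇒ULL (𝟏L u d)      = 𝟏L u (ILL⇒ULL d)
ILL⇒ULL (⊗R u f d e)  = ⊗R u f (ILL⇒ULL d) (ILL⇒ULL e)
ILL⇒ULL (⊗L u d)      = ⊗L u (ILL⇒ULL d)
ILL⇒ULL (⊸R u d)      = ⊸R u (ILL⇒ULL d)
ILL⇒ULL (⊸L u f d e)  = ⊸L u f (ILL⇒ULL d) (ILL⇒ULL e)
ILL⇒ULL (!R u d)      = !R u (ILL⇒ULL d)
ILL⇒ULL (!L u d)      = !L u (ILL⇒ULL d)

-- The `close` body excludes outputs from `⊗R` and `⊸L`, whose body is a `par`. Only the subject is
-- tracked, so `b` and `c` may change under renaming.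
data OutClose (v : Name) : Process → Set where
  outClose : ∀ {b c} → OutClose v (res (out (free v) b (close c)))

-- If `u` were `y`, the subject would become bound.
outClose-bind : ∀ {u v y} P → OutClose v (ν y ∙ u ⟨ y ⟩∙ P) → u ≡ v
outClose-bind {u} {y = y} (close _) o with u ≟ y
outClose-bind (close _) outClose | no _ = refl

-- Renaming keeps all constructors, so the shape can be traced back to the premise of `!L`.
outClose-subst : ∀ {v x u} P → OutClose v (P [ x / u ]) → v ≡ x ⊎ OutClose v P
outClose-subst {u = u} (res (out (free w) _ (close _))) o with w ≟ u
outClose-subst (res (out (free w) _ (close _))) outClose | yes _ = inj₁ refl
outClose-subst (res (out (free w) _ (close _))) outClose | no _ = inj₂ outClose

head≢right : ∀ {v z C} A Γ Δ → Distinct (v ∶ A ∷ Γ) Δ (z ∶ C ∷ []) → z ≢ v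
head≢right _ Γ Δ (v∉ ∷ _) refl =
  lookup v∉ (∈-map⁺ proj₁ (∈-++⁺ʳ Γ (∈-++⁺ʳ Δ (here refl)))) refl

-- Discarding the unrestricted names one by one brings `v` to the front.
linear-head≢right : ∀ {v z C} A Γ Δ → Distinct Γ (v ∶ A ∷ Δ) (z ∶ C ∷ []) → z ≢ v
linear-head≢right A []      Δ d       = head≢right A [] Δ d
linear-head≢right A (_ ∷ Γ) Δ (_ ∷ d) = linear-head≢right A Γ Δ d

outClose⇒right≢ : ∀ {Γ Δ P v z C} → OutClose v P → Γ ⨾ Δ ⊢ᴵ P ⦂ z ∶ C → z ≢ v
outClose⇒right≢ o (exch _ _ d) = outClose⇒right≢ o d
outClose⇒right≢ o (Copy {Γ} {Δ} {P} {A = A} d _) with refl ← outClose-bind P o =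
  head≢right A Γ Δ d
outClose⇒right≢ o (!L {Γ} {Δ} {P} {A = A} d e) with outClose-subst P o
... | inj₁ refl = linear-head≢right (! A) Γ Δ d
... | inj₂ o′   = outClose⇒right≢ o′ e

witness : Process
witness = ν 1 ∙ 0 ⟨ 1 ⟩∙ 1 ⟨⟩∙𝟎

witness∈𝔘 : 𝔘 witness
witness∈𝔘 = 0 ∶ ⊥ ∷ [] , [] , [] ,
  -- `⊥L` closes the copied name `1` on the left, so the right-hand side stays empty.
  CopyL {P = 1 ⟨⟩∙𝟎} {y = 1} ([] ∷ []) (⊥L (((λ ()) ∷ []) ∷ [] ∷ []))

witness∉ℑ : ¬ ℑ witness
witness∉ℑ (_ , _ , _ , _ , here z≡0 , d) = outClose⇒right≢ outClose d z≡0

theorem3p3 : (ℑ ⊆ 𝔘) × ¬ (ℑ ≐ 𝔘)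
theorem3p3 =
  (λ (Γ , Δ , x , A , _ , d) → Γ , Δ , x ∶ A ∷ [] , ILL⇒ULL d) ,
  λ ℑ≐𝔘 → witness∉ℑ (proj₂ ℑ≐𝔘 witness∈𝔘)
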